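{- Let $n, k, t$ be integers with $n \geq (k-t+1)(t+1)$. Let $\mathcal{F}$ be a family of subsets of $[n]=\{1,\ldots,n\}$, each of size at most $k$. Suppose that for any $A,B \in \mathcal{F}$ with $|A\cap B| <t$, we have $|A\triangle B| \leq k-t$. Then $$|\mathcal{F}|\leq \binom{n-t}{k-t} + \binom{n-t}{k-1-t} + \cdots + \binom{n-t}{0}.$$
   Context: $A\triangle B$ denotes the symmetric difference of $A$ and $B$. -}

module Defs where

open import Data.Nat using (ℕ; zero; suc; _+_)
open import Data.Nat.Combinatorics using (_C_)
open import Data.Fin.Subset using (Subset; _∪_; _─_)

infixl 6 _△_
_△_ : ∀ {n} → Subset n → Subset n → Subset n
A △ B = (A ─ B) ∪ (B ─ A)

binomSum : ℕ → ℕ → ℕ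
binomSum m zero    = 0
binomSum m (suc r) = binomSum m r + (m C r)

{-# OPTIONS --safe #-}
module Submission where

-- Adding a fixed element x to every member of size < k that lacks it (when the place
-- is free) preserves both hypotheses; once no such move is left, the family is
-- t-intersecting, because two members with a small intersection could be extended
-- by elements outside their union up to size k.
--
-- For t-intersecting families the elements are then removed one at a time, as in the
-- generating-set method of Ahlswede and Khachatrian. A trace on ℓ elements is weighted
-- by the number of its extensions to sets of size ≤ k. After shifting, two traces
-- through the last element that conflict without it cover all the other elements, so
-- their sizes have a fixed sum. Discarding one side of every conflict loses no weight:
-- for different sizes because the weight decreases with the size, and for equal sizes
-- by averaging over the elements, which is where n ≥ (k - t + 1)(t + 1) enters.
-- On t elements only the full set is left.

open import Defs
open import Data.Nat using (ℕ; zero; suc; _+_; _*_; _∸_; _≤_; _<_; z≤n; s≤s; s≤s⁻¹; ⌊_/2⌋; _<ᵇ_; _≤ᵇ_; _≡ᵇ_)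
open import Data.Nat.Properties
open import Data.Nat.Combinatorics using (_C_; nCk+nC[k+1]≡[n+1]C[k+1]; nC1≡n; k>n⇒nCk≡0)
open import Data.Nat.Induction using (<-wellFounded)
open import Data.Nat.Tactic.RingSolver using (solve-∀)
open import Algebra.Properties.CommutativeSemigroup +-commutativeSemigroup using (interchange)
open import Algebra.Properties.Semiring.Sum +-*-semiring
  using (sum; sum-replicate-zero; ∑-distrib-+; *-distribˡ-sum; *-distribʳ-sum; sum-permute)
open import Data.Bool using (Bool; true; false; _∧_; _∨_; not; T; if_then_else_)
import Data.Bool.Properties as Bool
open import Data.Fin using (Fin; zero; suc; toℕ; opposite)
import Data.Fin.Properties as Fin
open import Data.Fin.Permutation using (reverse)
open import Data.Fin.Subset using (Subset; inside; outside; _∩_; _∪_; ∣_∣)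
open import Data.Fin.Subset.Properties using (anySubset?; ∩-comm; ∣p∣≤n; ∣p∩q∣≤∣p∣; ∣p∩q∣≤∣q∣)
open import Data.List using (List; []; _∷_; length)
open import Data.List.Membership.Propositional using (_∈_)
import Data.List.Membership.DecPropositional as DecMembership
open import Data.List.Relation.Unary.All.Properties using (All¬⇒¬Any)
open import Data.List.Relation.Unary.AllPairs using (_∷_)
open import Data.List.Relation.Unary.Any using (here)
open import Data.List.Relation.Unary.Unique.Propositional using (Unique)
open import Data.Product using (∃-syntax; _×_; _,_; proj₁; proj₂)
open import Data.Sum using (_⊎_; inj₁; inj₂)
open import Data.Vec using ([]; _∷_; lookup; updateAt; head; tail)
open import Data.Vec.Properties
  using (≡-dec; lookup-zipWith; lookup∘updateAt; updateAt-id; updateAt-updateAt; updateAt-cong)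
open import Function using (_∘_; id; const)
open import Induction.WellFounded using (Acc; acc)
open import Relation.Binary.Definitions using (tri<; tri≈; tri>)
open import Relation.Binary.PropositionalEquality
open import Relation.Nullary using (yes; no; does; contradiction; _×-dec_)
open import Relation.Nullary.Decidable using (dec-true; dec-false)

-- Sums over all subsets

bit : Bool → ℕ
bit true  = 1
bit false = 0

∑ : ∀ {n} → (Subset n → ℕ) → ℕ
∑ {zero}  f = f []
∑ {suc n} f = ∑ (f ∘ (inside ∷_)) + ∑ (f ∘ (outside ∷_))

∑-cong : ∀ {n} {f g : Subset n → ℕ} → (∀ A → f A ≡ g A) → ∑ f ≡ ∑ g
∑-cong {zero}  f≗g = f≗g []
∑-cong {suc n} f≗g = cong₂ _+_ (∑-cong (f≗g ∘ (inside ∷_))) (∑-cong (f≗g ∘ (outside ∷_)))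

∑-mono : ∀ {n} {f g : Subset n → ℕ} → (∀ A → f A ≤ g A) → ∑ f ≤ ∑ g
∑-mono {zero}  f≤g = f≤g []
∑-mono {suc n} f≤g = +-mono-≤ (∑-mono (f≤g ∘ (inside ∷_))) (∑-mono (f≤g ∘ (outside ∷_)))

∑-mono-< : ∀ {n} {f g : Subset n → ℕ} → (∀ A → f A ≤ g A) → ∀ A → f A < g A → ∑ f < ∑ g
∑-mono-< f≤g []           f<g = f<g
∑-mono-< f≤g (true ∷ A)  f<g =
  +-mono-<-≤ (∑-mono-< (f≤g ∘ (inside ∷_)) A f<g) (∑-mono (f≤g ∘ (outside ∷_)))
∑-mono-< f≤g (false ∷ A) f<g =
  +-mono-≤-< (∑-mono (f≤g ∘ (inside ∷_))) (∑-mono-< (f≤g ∘ (outside ∷_)) A f<g)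

∑-+ : ∀ {n} (f g : Subset n → ℕ) → ∑ (λ A → f A + g A) ≡ ∑ f + ∑ g
∑-+ {zero}  f g = refl
∑-+ {suc n} f g = trans
  (cong₂ _+_ (∑-+ (f ∘ (inside ∷_)) (g ∘ (inside ∷_))) (∑-+ (f ∘ (outside ∷_)) (g ∘ (outside ∷_))))
  (interchange (∑ (f ∘ (inside ∷_))) (∑ (g ∘ (inside ∷_))) (∑ (f ∘ (outside ∷_))) (∑ (g ∘ (outside ∷_))))

∑-*ʳ : ∀ {n} (f : Subset n → ℕ) c → ∑ (λ A → f A * c) ≡ ∑ f * c
∑-*ʳ {zero}  f c = refl
∑-*ʳ {suc n} f c = trans
  (cong₂ _+_ (∑-*ʳ (f ∘ (inside ∷_)) c) (∑-*ʳ (f ∘ (outside ∷_)) c))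
  (sym (*-distribʳ-+ c (∑ (f ∘ (inside ∷_))) _))

∑-0 : ∀ n → ∑ {n} (const 0) ≡ 0
∑-0 zero    = refl
∑-0 (suc n) = cong₂ _+_ (∑-0 n) (∑-0 n)

-- Two involutions on subsets

toggle : ∀ {n} → Fin n → Subset n → Subset n
toggle x A = updateAt A x not

swap : ∀ {n} → Fin n → Subset (suc n) → Subset (suc n)
swap j (a ∷ A) = lookup A j ∷ updateAt A j (const a)

∑-toggle : ∀ {n} (x : Fin n) f → ∑ (f ∘ toggle x) ≡ ∑ f
∑-toggle zero    f = +-comm (∑ (f ∘ (outside ∷_))) _
∑-toggle (suc x) f = cong₂ _+_ (∑-toggle x (f ∘ (inside ∷_))) (∑-toggle x (f ∘ (outside ∷_)))

∑-swap : ∀ {n} (j : Fin n) f → ∑ (f ∘ swap j) ≡ ∑ f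
∑-swap zero    f = interchange (∑ (λ A → f (inside ∷ inside ∷ A))) _ _ _
∑-swap (suc j) f = begin
  ∑ (f ∘ swap (suc j))
    ≡⟨ interchange (∑ (λ A → f (swap (suc j) (inside ∷ inside ∷ A)))) _ _ _ ⟩
  ∑ (fixed inside ∘ swap j) + ∑ (fixed outside ∘ swap j)
    ≡⟨ cong₂ _+_ (∑-swap j (fixed inside)) (∑-swap j (fixed outside)) ⟩
  ∑ (fixed inside) + ∑ (fixed outside)
    ≡⟨ interchange (∑ (λ A → f (inside ∷ inside ∷ A))) _ _ _ ⟩
  ∑ f ∎
  where
  open ≡-Reasoning
  fixed : Bool → _ → ℕ
  fixed b A = f (head A ∷ b ∷ tail A)

toggle-involutive : ∀ {n} (x : Fin n) A → toggle x (toggle x A) ≡ A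
toggle-involutive x A = trans (updateAt-updateAt x A)
  (trans (updateAt-cong x Bool.not-involutive A) (updateAt-id x A))

swap-involutive : ∀ {n} (j : Fin n) A → swap j (swap j A) ≡ A
swap-involutive zero    (a ∷ b ∷ A) = refl
swap-involutive (suc j) (a ∷ b ∷ A) =
  cong (λ B → head B ∷ b ∷ tail B) (swap-involutive j (a ∷ A))

-- Cardinalities

∣∷∣ : ∀ {n} a (A : Subset n) → ∣ a ∷ A ∣ ≡ bit a + ∣ A ∣
∣∷∣ true  A = refl
∣∷∣ false A = refl

-- The old and the new contribution of `x` stand on opposite sides. This avoids subtraction and
-- serves insertion, toggling and swapping alike.
∣updateAt∩updateAt∣ : ∀ {n} (x : Fin n) (A B : Subset n) f g →
  ∣ updateAt A x f ∩ updateAt B x g ∣ + bit (lookup A x ∧ lookup B x) ≡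
  ∣ A ∩ B ∣ + bit (f (lookup A x) ∧ g (lookup B x))
∣updateAt∩updateAt∣ zero (a ∷ A) (b ∷ B) f g
  rewrite ∣∷∣ (f a ∧ g b) (A ∩ B) | ∣∷∣ (a ∧ b) (A ∩ B) =
  lemma (bit (f a ∧ g b)) (bit (a ∧ b)) ∣ A ∩ B ∣
  where
  lemma : ∀ p q r → p + r + q ≡ q + r + p
  lemma = solve-∀
∣updateAt∩updateAt∣ (suc x) (a ∷ A) (b ∷ B) f g
  rewrite ∣∷∣ (a ∧ b) (updateAt A x f ∩ updateAt B x g) | ∣∷∣ (a ∧ b) (A ∩ B)
        | +-assoc (bit (a ∧ b)) ∣ updateAt A x f ∩ updateAt B x g ∣ (bit (lookup A x ∧ lookup B x))
        | ∣updateAt∩updateAt∣ x A B f g = sym (+-assoc (bit (a ∧ b)) _ _)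

∣updateAt∩∣ : ∀ {n} (x : Fin n) (A B : Subset n) f →
  ∣ updateAt A x f ∩ B ∣ + bit (lookup A x ∧ lookup B x) ≡
  ∣ A ∩ B ∣ + bit (f (lookup A x) ∧ lookup B x)
∣updateAt∩∣ x A B f =
  subst (λ B′ → ∣ updateAt A x f ∩ B′ ∣ + bit (lookup A x ∧ lookup B x) ≡
                ∣ A ∩ B ∣ + bit (f (lookup A x) ∧ lookup B x)) (updateAt-id x B) (∣updateAt∩updateAt∣ x A B f id)

∣updateAt∩∣-outside : ∀ {n} (x : Fin n) A B f → lookup A x ≡ outside →
  ∣ updateAt A x f ∩ B ∣ ≡ bit (f outside ∧ lookup B x) + ∣ A ∩ B ∣
∣updateAt∩∣-outside x A B f x∉A with ∣updateAt∩∣ x A B f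
... | eq rewrite x∉A = trans (sym (+-identityʳ _)) (trans eq (+-comm ∣ A ∩ B ∣ _))

∣updateAt∣ : ∀ {n} (x : Fin n) (A : Subset n) f →
  ∣ updateAt A x f ∣ + bit (lookup A x) ≡ ∣ A ∣ + bit (f (lookup A x))
∣updateAt∣ zero (a ∷ A) f rewrite ∣∷∣ (f a) A | ∣∷∣ a A = lemma (bit (f a)) (bit a) ∣ A ∣
  where
  lemma : ∀ p q r → p + r + q ≡ q + r + p
  lemma = solve-∀
∣updateAt∣ (suc x) (a ∷ A) f
  rewrite ∣∷∣ a (updateAt A x f) | ∣∷∣ a A
        | +-assoc (bit a) ∣ updateAt A x f ∣ (bit (lookup A x))
        | ∣updateAt∣ x A f = sym (+-assoc (bit a) _ _)

∣∪∣+∣∩∣ : ∀ {n} (A B : Subset n) → ∣ A ∪ B ∣ + ∣ A ∩ B ∣ ≡ ∣ A ∣ + ∣ B ∣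
∣∪∣+∣∩∣ []          []          = refl
∣∪∣+∣∩∣ (true ∷ A)  (true ∷ B)  =
  cong suc (trans (+-suc _ _) (trans (cong suc (∣∪∣+∣∩∣ A B)) (sym (+-suc _ _))))
∣∪∣+∣∩∣ (true ∷ A)  (false ∷ B) = cong suc (∣∪∣+∣∩∣ A B)
∣∪∣+∣∩∣ (false ∷ A) (true ∷ B)  = trans (cong suc (∣∪∣+∣∩∣ A B)) (sym (+-suc _ _))
∣∪∣+∣∩∣ (false ∷ A) (false ∷ B) = ∣∪∣+∣∩∣ A B

∣△∣+2∣∩∣ : ∀ {n} (A B : Subset n) → ∣ A △ B ∣ + 2 * ∣ A ∩ B ∣ ≡ ∣ A ∣ + ∣ B ∣
∣△∣+2∣∩∣ []          []          = refl
∣△∣+2∣∩∣ (true ∷ A)  (true ∷ B)  =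
  trans (lemma ∣ A △ B ∣ ∣ A ∩ B ∣) (trans (cong (2 +_) (∣△∣+2∣∩∣ A B)) (cong suc (sym (+-suc _ _))))
  where
  lemma : ∀ p q → p + 2 * suc q ≡ 2 + (p + 2 * q)
  lemma = solve-∀
∣△∣+2∣∩∣ (true ∷ A)  (false ∷ B) = cong suc (∣△∣+2∣∩∣ A B)
∣△∣+2∣∩∣ (false ∷ A) (true ∷ B)  = trans (cong suc (∣△∣+2∣∩∣ A B)) (sym (+-suc _ _))
∣△∣+2∣∩∣ (false ∷ A) (false ∷ B) = ∣△∣+2∣∩∣ A B

missing-element : ∀ {n} (A : Subset n) → ∣ A ∣ < n → ∃[ x ] lookup A x ≡ outside
missing-element (false ∷ A) _         = zero , refl
missing-element (true ∷ A)  (s≤s A<n) = let x , eq = missing-element A A<n in suc x , eq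

lookup-∪-outside : ∀ {n} (A B : Subset n) x → lookup (A ∪ B) x ≡ outside →
  lookup A x ≡ outside × lookup B x ≡ outside
lookup-∪-outside (false ∷ A) (false ∷ B) zero    _  = refl , refl
lookup-∪-outside (a ∷ A)     (b ∷ B)     (suc x) eq = lookup-∪-outside A B x eq

-- Families and their weighted totals

Family : ℕ → Set
Family n = Subset n → Bool

total : ∀ {n} → (Subset n → ℕ) → Family n → ℕ
total w g = ∑ (λ A → bit (g A) * w A)

Pairwise : ∀ {n} → (Subset n → Subset n → Set) → Family n → Set
Pairwise R g = ∀ A B → g A ≡ true → g B ≡ true → R A B

m+m≤n+n⇒m≤n : ∀ {m n} → m + m ≤ n + n → m ≤ n
m+m≤n+n⇒m≤n 2m≤2n = ≮⇒≥ λ n<m → <⇒≱ (+-mono-< n<m n<m) 2m≤2n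

m+m<n+n⇒m<n : ∀ {m n} → m + m < n + n → m < n
m+m<n+n⇒m<n 2m<2n = ≰⇒> λ n≤m → ≤⇒≯ (+-mono-≤ n≤m n≤m) 2m<2n

-- Compressions along involutions

-- The new membership bit of a set whose own and partner's source flags are
-- p, q and whose own and partner's old membership bits are x, y.
compressBit : (p q x y : Bool) → Bool
compressBit true  q     x y = x ∧ y
compressBit false true  x y = x ∨ y
compressBit false false x y = x

compressBit-total : ∀ p q x y {a b} → (p ≡ true → q ≡ false) →
  (p ≡ true → b ≡ a) → (q ≡ true → a ≡ b) →
  bit (compressBit p q x y) * a + bit (compressBit q p y x) * b ≡ bit x * a + bit y * b
compressBit-total true  true  x     y     p⇒¬q _ _ = contradiction (p⇒¬q refl) λ ()
compressBit-total false false x     y     _ _ _ = refl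
compressBit-total true  false true  true  _ _ _ = refl
compressBit-total true  false true  false _ b≡a _ rewrite b≡a refl = sym (+-identityʳ _)
compressBit-total true  false false true  _ _ _ = refl
compressBit-total true  false false false _ _ _ = refl
compressBit-total false true  true  true  _ _ _ = refl
compressBit-total false true  true  false _ _ _ = refl
compressBit-total false true  false true  _ _ a≡b rewrite a≡b refl = +-identityʳ _
compressBit-total false true  false false _ _ _ = refl

compressBit-decreasing : ∀ p q x y {a b} → (p ≡ true → q ≡ false) →
  (p ≡ true → b < a) → (q ≡ true → a < b) →
  bit (compressBit p q x y) * a + bit (compressBit q p y x) * b ≤ bit x * a + bit y * b
compressBit-decreasing true  true  x     y     p⇒¬q _ _ = contradiction (p⇒¬q refl) λ ()
compressBit-decreasing false false x     y     _ _ _ = ≤-refl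
compressBit-decreasing true  false true  true  _ _ _ = ≤-refl
compressBit-decreasing true  false true  false {a} {b} _ b<a _
  rewrite +-identityʳ (a + 0) = +-monoˡ-≤ 0 (<⇒≤ (b<a refl))
compressBit-decreasing true  false false true  _ _ _ = ≤-refl
compressBit-decreasing true  false false false _ _ _ = ≤-refl
compressBit-decreasing false true  true  true  _ _ _ = ≤-refl
compressBit-decreasing false true  true  false _ _ _ = ≤-refl
compressBit-decreasing false true  false true  {a} {b} _ _ a<b
  rewrite +-identityʳ (a + 0) = +-monoˡ-≤ 0 (<⇒≤ (a<b refl))
compressBit-decreasing false true  false false _ _ _ = ≤-refl

-- A source is moved to its partner whenever the place is free.
record Compression (n : ℕ) : Set where
  field
    move        : Subset n → Subset n
    source      : Subset n → Bool
    involutive  : ∀ A → move (move A) ≡ A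
    source-move : ∀ A → source A ≡ true → source (move A) ≡ false
    ∑-move      : ∀ f → ∑ (f ∘ move) ≡ ∑ f

  compress : Family n → Family n
  compress g A = compressBit (source A) (source (move A)) (g A) (g (move A))

  Stable : Family n → Set
  Stable g = ∀ A → source A ≡ true → g A ≡ true → g (move A) ≡ true

  Decreasing : (Subset n → ℕ) → Set
  Decreasing μ = ∀ A → source A ≡ true → μ (move A) < μ A

  Invariant : (Subset n → ℕ) → Set
  Invariant w = ∀ A → source A ≡ true → w (move A) ≡ w A

  -- Every set occurs once as `A` and once as a partner, so a comparison on each pair `A`, `move A`
  -- yields a comparison of doubled totals, which is then halved.
  ∑-pairs : ∀ f → ∑ (λ A → f A + f (move A)) ≡ ∑ f + ∑ f
  ∑-pairs f = trans (∑-+ f (f ∘ move)) (cong (∑ f +_) (∑-move f))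

  compress-move : ∀ g A →
    compress g (move A) ≡ compressBit (source (move A)) (source A) (g (move A)) (g A)
  compress-move g A =
    cong (λ B → compressBit (source (move A)) (source B) (g (move A)) (g B)) (involutive A)

  at-partner : ∀ {μ : Subset n → ℕ} (_~_ : ℕ → ℕ → Set) →
    (∀ A → source A ≡ true → μ (move A) ~ μ A) →
    ∀ A → source (move A) ≡ true → μ A ~ μ (move A)
  at-partner {μ} _~_ h A s = subst (λ B → μ B ~ μ (move A)) (involutive A) (h (move A) s)

  total-compress : ∀ {w} → Invariant w → ∀ g → total w (compress g) ≡ total w g
  total-compress {w} inv g = ≤-antisym (m+m≤n+n⇒m≤n (≤-reflexive eq)) (m+m≤n+n⇒m≤n (≤-reflexive (sym eq)))
    where
    pairs : ∀ A → bit (compress g A) * w A + bit (compress g (move A)) * w (move A) ≡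
                  bit (g A) * w A + bit (g (move A)) * w (move A)
    pairs A rewrite compress-move g A =
      compressBit-total (source A) (source (move A)) (g A) (g (move A))
        (source-move A) (inv A) (at-partner {w} _≡_ inv A)
    eq : total w (compress g) + total w (compress g) ≡ total w g + total w g
    eq = trans (sym (∑-pairs _)) (trans (∑-cong pairs) (∑-pairs _))

  total-compress-< : ∀ {μ} → Decreasing μ → ∀ g A →
    source A ≡ true → g A ≡ true → g (move A) ≡ false → total μ (compress g) < total μ g
  total-compress-< {μ} dec g A sA gA gmA = m+m<n+n⇒m<n
    (subst₂ _<_ (∑-pairs _) (∑-pairs _) (∑-mono-< pairs A strict))
    where
    pairs : ∀ B → bit (compress g B) * μ B + bit (compress g (move B)) * μ (move B) ≤
                  bit (g B) * μ B + bit (g (move B)) * μ (move B)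
    pairs B rewrite compress-move g B =
      compressBit-decreasing (source B) (source (move B)) (g B) (g (move B))
        (source-move B) (dec B) (at-partner {μ} _<_ dec B)
    strict : bit (compress g A) * μ A + bit (compress g (move A)) * μ (move A) <
             bit (g A) * μ A + bit (g (move A)) * μ (move A)
    strict rewrite compress-move g A | source-move A sA | sA | gA | gmA
                 | +-identityʳ (μ A + 0) = +-monoˡ-< 0 (dec A sA)

  compress-origin : ∀ g A → compress g A ≡ true →
    (g A ≡ true × (source A ≡ true → g (move A) ≡ true)) ⊎
    (source (move A) ≡ true × g (move A) ≡ true)
  compress-origin g A eq with source A | source (move A) | g A | g (move A)
  ... | true  | _     | true  | true  = inj₁ (refl , const refl)
  ... | false | true  | true  | _     = inj₁ (refl , λ ())
  ... | false | true  | false | true  = inj₂ (refl , refl)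
  ... | false | false | true  | _     = inj₁ (refl , λ ())

  -- A new member comes from its partner in `g`. An old member that is a source stayed only because
  -- its partner lies in `g` too. So a new set and an old source are compared through both partners,
  -- which `both` moves together; against an old non-source only one set moves, which is `one`.
  compress-pairwise : ∀ {R : Subset n → Subset n → Set} → (∀ A B → R A B → R B A) →
    ∀ {g} →
    (∀ A B → source A ≡ true → source B ≡ true ⊎ source (move B) ≡ true →
       R A B → R (move A) (move B)) →
    (∀ A B → source A ≡ true → source B ≡ false → R A B → R (move A) B) →
    Pairwise R g → Pairwise R (compress g)
  compress-pairwise {R} R-sym {g} both one Rg A B A∈ B∈ =
    pairwise A B (compress-origin g A A∈) (compress-origin g B B∈)
    where
    Old New : Subset n → Set
    Old A = g A ≡ true × (source A ≡ true → g (move A) ≡ true)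
    New A = source (move A) ≡ true × g (move A) ≡ true
    new-old : ∀ A B → New A → Old B → R A B
    new-old A B (sA , gmA) (gB , B-stays) with source B in sB
    ... | false = subst (λ A → R A B) (involutive A) (one _ B sA sB (Rg _ B gmA gB))
    ... | true  = subst₂ R (involutive A) (involutive B)
      (both _ _ sA (inj₂ (trans (cong source (involutive B)) sB)) (Rg _ _ gmA (B-stays refl)))
    pairwise : ∀ A B → Old A ⊎ New A → Old B ⊎ New B → R A B
    pairwise A B (inj₁ (gA , _)) (inj₁ (gB , _)) = Rg A B gA gB
    pairwise A B (inj₁ oldA)     (inj₂ newB)     = R-sym B A (new-old B A newB oldA)
    pairwise A B (inj₂ newA)     (inj₁ oldB)     = new-old A B newA oldB
    pairwise A B (inj₂ (sA , gmA)) (inj₂ (sB , gmB)) =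
      subst₂ R (involutive A) (involutive B) (both _ _ sA (inj₁ sB) (Rg _ _ gmA gmB))

module _ {m n} (c : Fin m → Compression n) where
  open Compression

  -- As long as some compression moves a member, applying it lowers `total μ` and keeps `total w`,
  -- so the process ends, and it ends at a stable family.
  stabilise : ∀ μ w → (∀ j → Decreasing (c j) μ) → (∀ j → Invariant (c j) w) →
    (P : Family n → Set) → (∀ j g → P g → P (compress (c j) g)) →
    ∀ g → P g → ∃[ g′ ] P g′ × (∀ j → Stable (c j) g′) × total w g′ ≡ total w g
  stabilise μ w dec inv P pres g Pg = go g Pg (<-wellFounded _)
    where
    go : ∀ g → P g → Acc _<_ (total μ g) →
      ∃[ g′ ] P g′ × (∀ j → Stable (c j) g′) × total w g′ ≡ total w g
    go g Pg (acc rec) with Fin.any? (λ j → anySubset? (λ A →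
      (source (c j) A Bool.≟ true) ×-dec ((g A Bool.≟ true) ×-dec (g (move (c j) A) Bool.≟ false))))
    ... | yes (j , A , sA , gA , gmA) =
      let g′ , Pg′ , stable , eq = go (compress (c j) g) (pres j g Pg)
                                      (rec (total-compress-< (c j) (dec j) g A sA gA gmA))
      in g′ , Pg′ , stable , trans eq (total-compress (c j) (inv j) g)
    ... | no none = g , Pg , stable , refl
      where
      stable : ∀ j → Stable (c j) g
      stable j A sA gA with g (move (c j) A) in eq
      ... | true  = refl
      ... | false = contradiction (j , A , sA , gA , eq) none

-- Binomial weights

-- The identity (q + 1) C(m, q + 1) = (m - q) C(m, q), with the subtracted term moved to the left.
C-absorption : ∀ m q → suc q * (m C suc q) + q * (m C q) ≡ m * (m C q)
C-absorption zero    zero    = refl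
C-absorption zero    (suc q)
  rewrite k>n⇒nCk≡0 {0} {suc (suc q)} (s≤s z≤n) | k>n⇒nCk≡0 {0} {suc q} (s≤s z≤n)
        | *-zeroʳ q = refl
C-absorption (suc m) zero    rewrite nC1≡n (suc m) = lemma m
  where
  lemma : ∀ m → 1 * suc m + 0 ≡ suc m * 1
  lemma = solve-∀
C-absorption (suc m) (suc q)
  rewrite sym (nCk+nC[k+1]≡[n+1]C[k+1] m (suc q)) | sym (nCk+nC[k+1]≡[n+1]C[k+1] m q) =
  trans (regroup q (m C q) (m C suc q) (m C suc (suc q)))
    (trans (cong₂ (λ x y → x + y + (m C q + m C suc q)) (C-absorption m (suc q)) (C-absorption m q))
      (collect m (m C q) (m C suc q)))
  where
  regroup : ∀ q a b c → suc (suc q) * (b + c) + suc q * (a + b) ≡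
    (suc (suc q) * c + suc q * b) + (suc q * b + q * a) + (a + b)
  regroup = solve-∀
  collect : ∀ m a b → m * b + m * a + (a + b) ≡ suc m * (a + b)
  collect = solve-∀

binomSum-pascal : ∀ m q → binomSum (suc m) (suc q) ≡ binomSum m (suc q) + binomSum m q
binomSum-pascal m zero    = refl
binomSum-pascal m (suc q) rewrite binomSum-pascal m q | sym (nCk+nC[k+1]≡[n+1]C[k+1] m q) =
  lemma (binomSum m q) (m C q) (m C suc q)
  where
  lemma : ∀ b x y → b + x + b + (x + y) ≡ b + x + y + (b + x)
  lemma = solve-∀

-- By induction `t * binomSum m (suc q)` is at most (t + 1) C(m, q). The hypothesis says m - q ≥ (t
-- + 1)(q + 1), so absorption bounds this by C(m, q + 1). The term `q * (m C q)` is added to both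
-- sides to stand for the subtraction.
binomSum-dominated : ∀ t m q → (2 + t) * q ≤ suc m → t * binomSum m q ≤ m C q
binomSum-dominated t m zero    _ rewrite *-zeroʳ t = z≤n
binomSum-dominated t m (suc q) h = *-cancelˡ-≤ (suc q) (+-cancelʳ-≤ (q * (m C q)) _ _ (begin
  suc q * (t * (binomSum m q + m C q)) + q * (m C q)
    ≡⟨ cong (λ x → suc q * x + q * (m C q)) (*-distribˡ-+ t (binomSum m q) (m C q)) ⟩
  suc q * (t * binomSum m q + t * (m C q)) + q * (m C q)
    ≤⟨ +-monoˡ-≤ _ (*-monoʳ-≤ (suc q) (+-monoˡ-≤ _ (binomSum-dominated t m q smaller))) ⟩
  suc q * (m C q + t * (m C q)) + q * (m C q)
    ≡⟨ factor t q (m C q) ⟩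
  (suc t * suc q + q) * (m C q)
    ≤⟨ *-monoˡ-≤ (m C q) (s≤s⁻¹ (≤-trans (≤-reflexive (shape t q)) h)) ⟩
  m * (m C q)
    ≡⟨ C-absorption m q ⟨
  suc q * (m C suc q) + q * (m C q) ∎))
  where
  open ≤-Reasoning
  smaller : (2 + t) * q ≤ suc m
  smaller = ≤-trans (*-monoʳ-≤ (2 + t) (n≤1+n q)) h
  factor : ∀ t q c → suc q * (c + t * c) + q * c ≡ (suc t * suc q + q) * c
  factor = solve-∀
  shape : ∀ t q → suc (suc t * suc q + q) ≡ (2 + t) * suc q
  shape = solve-∀

binomSum-mono : ∀ m {p q} → p ≤ q → binomSum m p ≤ binomSum m q
binomSum-mono m {q = q} z≤n = z≤n
binomSum-mono m {suc p} {suc q} (s≤s p≤q) with m≤n⇒m<n∨m≡n p≤q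
... | inj₂ refl = ≤-refl
... | inj₁ p<q  = ≤-trans (binomSum-mono m p<q) (m≤m+n _ _)

-- The number of ways to extend a set of size i by at most k - i of m further
-- elements, where K = k + 1.
weight : (K m i : ℕ) → ℕ
weight K m i = binomSum m (K ∸ i)

-- An extension either omits the additional element or contains it, and in the second case it
-- extends a set of size i + 1.
weight-pascal : ∀ K m i → weight K (suc m) i ≡ weight K m i + weight K m (suc i)
weight-pascal zero    m zero    = refl
weight-pascal zero    m (suc i) = refl
weight-pascal (suc K) m zero    = binomSum-pascal m K
weight-pascal (suc K) m (suc i) = weight-pascal K m i

weight-antitone : ∀ K m i → weight K m (suc i) ≤ weight K m i
weight-antitone K m i = binomSum-mono m (∸-monoʳ-≤ K (n≤1+n i))

-- With i = t + s + 1 and q = K - i - 1, the two weights are b = `binomSum m q` and b + C(m, q). The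
-- claim becomes t b ≤ (s + 1) C(m, q), which follows from domination; the threshold supplies its
-- hypothesis. For K ≤ i + 1 the left side vanishes.
middle-weights : ∀ K t m s → (K ∸ suc t) * (suc t + 1) ≤ suc (suc (t + s) + suc s) + m →
  suc (t + s) * weight K m (suc (suc (t + s))) ≤ suc s * weight K m (suc (t + s))
middle-weights K t m s h with ≤-total K (suc (suc (t + s)))
... | inj₁ K≤ rewrite m≤n⇒m∸n≡0 K≤ | *-zeroʳ (suc (t + s)) = z≤n
... | inj₂ ≤K with K ∸ suc (suc (t + s)) | m+[n∸m]≡n ≤K
... | q | refl = begin
  suc (t + s) * binomSum m q               ≡⟨ split t s (binomSum m q) ⟩
  suc s * binomSum m q + t * binomSum m q  ≤⟨ +-monoʳ-≤ _ (binomSum-dominated t m q room) ⟩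
  suc s * binomSum m q + m C q             ≤⟨ +-monoʳ-≤ _ (m≤n*m (m C q) (suc s)) ⟩
  suc s * binomSum m q + suc s * (m C q)   ≡⟨ *-distribˡ-+ (suc s) (binomSum m q) (m C q) ⟨
  suc s * binomSum m (suc q)               ≡⟨ cong (λ p → suc s * binomSum m p) (size (t + s) q) ⟨
  suc s * weight (suc (suc (t + s + q))) m (suc (t + s)) ∎
  where
  open ≤-Reasoning
  split : ∀ t s b → suc (t + s) * b ≡ suc s * b + t * b
  split = solve-∀
  size : ∀ x q → suc (x + q) ∸ x ≡ suc q
  size x q = trans (+-∸-assoc 1 (m≤m+n x q)) (cong suc (m+n∸m≡n x q))
  range : suc (t + s + q) ∸ t ≡ suc s + q
  range = trans (cong (_∸ t) (lemma t s q)) (m+n∸m≡n t (suc s + q))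
    where
    lemma : ∀ t s q → suc (t + s + q) ≡ t + (suc s + q)
    lemma = solve-∀
  -- Expanding (s + 1 + q)(t + 2) leaves a surplus `t * s`, which is given away.
  room : (2 + t) * q ≤ suc m
  room = +-cancelʳ-≤ (t + 2 * suc s) _ _ (begin
    (2 + t) * q + (t + 2 * suc s)         ≤⟨ m≤m+n _ (t * s) ⟩
    (2 + t) * q + (t + 2 * suc s) + t * s ≡⟨ expand t s q ⟩
    (suc s + q) * (suc t + 1)             ≡⟨ cong (_* (suc t + 1)) range ⟨
    (suc (t + s + q) ∸ t) * (suc t + 1)   ≤⟨ h ⟩
    suc (suc (t + s) + suc s) + m         ≡⟨ rest t s m ⟩
    suc m + (t + 2 * suc s)               ∎)
    where
    expand : ∀ t s q → (2 + t) * q + (t + 2 * suc s) + t * s ≡ (suc s + q) * (suc t + 1)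
    expand = solve-∀
    rest : ∀ t s m → suc (suc (t + s) + suc s) + m ≡ suc m + (t + 2 * suc s)
    rest = solve-∀

-- Shifting

∣swap∣ : ∀ {n} (j : Fin n) A → ∣ swap j A ∣ ≡ ∣ A ∣
∣swap∣ j (a ∷ A) rewrite ∣∷∣ (lookup A j) (updateAt A j (const a)) | ∣∷∣ a A =
  trans (+-comm (bit (lookup A j)) _) (trans (∣updateAt∣ j A (const a)) (+-comm ∣ A ∣ _))

∣swap∩swap∣ : ∀ {n} (j : Fin n) A B → ∣ swap j A ∩ swap j B ∣ ≡ ∣ A ∩ B ∣
∣swap∩swap∣ j (a ∷ A) (b ∷ B)
  rewrite ∣∷∣ (lookup A j ∧ lookup B j) (updateAt A j (const a) ∩ updateAt B j (const b))
        | ∣∷∣ (a ∧ b) (A ∩ B) =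
  trans (+-comm (bit (lookup A j ∧ lookup B j)) _)
    (trans (∣updateAt∩updateAt∣ j A B (const a) (const b)) (+-comm ∣ A ∩ B ∣ _))

-- The head plays the part of the last element: a shift replaces it by a later position `j`, since
-- the head is the element to be removed next.
shiftable : ∀ {n} → Fin n → Subset (suc n) → Bool
shiftable j (a ∷ A) = a ∧ not (lookup A j)

-- If `B` contains the head and is not shiftable, it also contains `j`, so the common element lost
-- at the head is regained at `j`.
∣swap∩∣ : ∀ {n} (j : Fin n) A B → shiftable j A ≡ true → shiftable j B ≡ false →
  ∣ A ∩ B ∣ ≤ ∣ swap j A ∩ B ∣
∣swap∩∣ j (true ∷ A) (b ∷ B) sA sB with lookup A j in j∉A
... | false rewrite ∣∷∣ b (A ∩ B) | ∣updateAt∩∣-outside j A B (const inside) j∉A =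
  +-monoˡ-≤ ∣ A ∩ B ∣ (bits b (lookup B j) sB)
  where
  bits : ∀ b c → b ∧ not c ≡ false → bit b ≤ bit c
  bits true  true  _ = s≤s z≤n
  bits false _     _ = z≤n

shift : ∀ {n} → Fin n → Compression (suc n)
shift j = record
  { move        = swap j
  ; source      = shiftable j
  ; involutive  = swap-involutive j
  ; source-move = shiftable-swap
  ; ∑-move      = ∑-swap j
  }
  where
  shiftable-swap : ∀ A → shiftable j A ≡ true → shiftable j (swap j A) ≡ false
  shiftable-swap (true ∷ A) sA with lookup A j
  ... | false = refl

headBit : ∀ {n} → Subset (suc n) → ℕ
headBit A = bit (head A)

shift-decreasing : ∀ {n} (j : Fin n) → Compression.Decreasing (shift j) headBit
shift-decreasing j (true ∷ A) sA with lookup A j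
... | false = s≤s z≤n

Intersecting : ∀ {n} → ℕ → Family n → Set
Intersecting t = Pairwise (λ A B → t ≤ ∣ A ∩ B ∣)

shift-intersecting : ∀ {n} t (j : Fin n) g →
  Intersecting t g → Intersecting t (Compression.compress (shift j) g)
shift-intersecting t j g = Compression.compress-pairwise (shift j)
  (λ A B → subst (λ C → t ≤ ∣ C ∣) (∩-comm A B))
  (λ A B _ _ → subst (t ≤_) (sym (∣swap∩swap∣ j A B)))
  (λ A B sA sB t≤ → ≤-trans t≤ (∣swap∩∣ j A B sA sB))

-- An element outside A ∪ B could take the place of the head in A, and the result
-- would meet inside ∷ B in ∣ A ∩ B ∣ elements only.
shifted-conflict : ∀ {n} t (g : Family (suc n)) → (∀ j → Compression.Stable (shift j) g) →
  Intersecting (suc t) g → ∀ A B → g (inside ∷ A) ≡ true → g (inside ∷ B) ≡ true →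
  ∣ A ∩ B ∣ < suc t → ∣ A ∣ + ∣ B ∣ ≡ n + t × ∣ A ∪ B ∣ ≡ n
shifted-conflict {n} t g stable int A B gA gB A∩B<t with ∣ A ∪ B ∣ <? n
... | yes A∪B<n =
  let j , j∉A∪B = missing-element (A ∪ B) A∪B<n
      j∉A , j∉B = lookup-∪-outside A B j j∉A∪B
      shifted   = stable j (inside ∷ A) (cong not j∉A) gA
      same      = trans (∣updateAt∩∣-outside j A B (const inside) j∉A) (cong (λ b → bit b + ∣ A ∩ B ∣) j∉B)
      meet      = int _ _ (subst (λ a → g (a ∷ updateAt A j (const inside)) ≡ true) j∉A shifted) gB
  in contradiction (subst (suc t ≤_) same meet) (<⇒≱ A∩B<t)
... | no A∪B≮n = trans (sym (∣∪∣+∣∩∣ A B)) (cong₂ _+_ full meet) , full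
  where
  full : ∣ A ∪ B ∣ ≡ n
  full = ≤-antisym (∣p∣≤n (A ∪ B)) (≮⇒≥ A∪B≮n)
  meet : ∣ A ∩ B ∣ ≡ t
  -- The shared head accounts for one of the `suc t` common elements, so `A` and `B` still have at
  -- least `t`.
  meet = ≤-antisym (≤-pred A∩B<t) (≤-pred (int _ _ gA gB))

-- Discarding conflicting traces

sum-mono : ∀ {n} {f g : Fin n → ℕ} → (∀ i → f i ≤ g i) → sum f ≤ sum g
sum-mono {zero}  _   = z≤n
sum-mono {suc n} f≤g = +-mono-≤ (f≤g zero) (sum-mono (f≤g ∘ suc))

sum-≤-by-pairs : ∀ {n} (f g : Fin n → ℕ) →
  (∀ i → f i + f (opposite i) ≤ g i + g (opposite i)) → sum f ≤ sum g
sum-≤-by-pairs f g h = m+m≤n+n⇒m≤n (subst₂ _≤_ (doubled f) (doubled g) (sum-mono h))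
  where
  doubled : ∀ f → sum (λ i → f i + f (opposite i)) ≡ sum f + sum f
  doubled f = trans (∑-distrib-+ f (f ∘ opposite)) (cong (sum f +_) (sym (sum-permute f reverse)))

average≤maximum : ∀ {n} (f : Fin (suc n) → ℕ) → ∃[ j ] sum f ≤ suc n * f j
average≤maximum {zero}  f = zero , ≤-refl
average≤maximum {suc n} f with average≤maximum (f ∘ suc)
... | j , avg with ≤-total (f zero) (f (suc j))
... | inj₁ f₀≤ = suc j , +-mono-≤ f₀≤ avg
... | inj₂ ≤f₀ = zero , +-monoʳ-≤ (f zero) (≤-trans avg (*-monoʳ-≤ (suc n) ≤f₀))

∑-sum-comm : ∀ {n m} (f : Subset n → Fin m → ℕ) →
  ∑ (λ A → sum (f A)) ≡ sum (λ i → ∑ (λ A → f A i))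
∑-sum-comm {zero}  f = refl
∑-sum-comm {suc n} f = trans
  (cong₂ _+_ (∑-sum-comm (f ∘ (inside ∷_))) (∑-sum-comm (f ∘ (outside ∷_))))
  (sym (∑-distrib-+ (λ i → ∑ (λ A → f (inside ∷ A) i)) (λ i → ∑ (λ A → f (outside ∷ A) i))))

sum-indicator : ∀ {m a} → a < m → sum {m} (λ i → bit (a ≡ᵇ toℕ i)) ≡ 1
sum-indicator {suc m} {zero}  _         = cong suc (sum-replicate-zero m)
sum-indicator {suc m} {suc a} (s≤s a<m) = sum-indicator a<m

sum-missing : ∀ {n} (A : Subset n) → sum (λ j → bit (not (lookup A j))) + ∣ A ∣ ≡ n
sum-missing []          = refl
sum-missing (true ∷ A)  = trans (+-suc _ _) (cong suc (sum-missing A))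
sum-missing (false ∷ A) = cong suc (sum-missing A)

layer : ∀ {n} → ℕ → (Subset n → ℕ) → ℕ
layer i f = ∑ (λ A → bit (∣ A ∣ ≡ᵇ i) * f A)

-- Layers above `n` are empty, so `m` may be larger than n + 1. With m = N + 1 the reversal of the
-- indices becomes i ↦ N - i.
∑-layers : ∀ {n m} → n < m → (f : Subset n → ℕ) → ∑ f ≡ sum {m} (λ i → layer (toℕ i) f)
∑-layers {n} {m} n<m f = trans (∑-cong split) (∑-sum-comm {m = m} (λ A i → bit (∣ A ∣ ≡ᵇ toℕ i) * f A))
  where
  split : ∀ A → f A ≡ sum {m} (λ i → bit (∣ A ∣ ≡ᵇ toℕ i) * f A)
  split A = sym (trans (sym (*-distribʳ-sum {m} (f A) (λ i → bit (∣ A ∣ ≡ᵇ toℕ i))))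
    (trans (cong (_* f A) (sum-indicator (≤-<-trans (∣p∣≤n A) n<m))) (*-identityˡ (f A))))

layer-cong : ∀ {n} i {f g : Subset n → ℕ} → (∀ A → ∣ A ∣ ≡ i → f A ≡ g A) → layer i f ≡ layer i g
layer-cong i {f} {g} f≗g = ∑-cong pointwise
  where
  pointwise : ∀ A → bit (∣ A ∣ ≡ᵇ i) * f A ≡ bit (∣ A ∣ ≡ᵇ i) * g A
  pointwise A with ∣ A ∣ ≡ᵇ i in eq
  ... | true  = cong (1 *_) (f≗g A (≡ᵇ⇒≡ ∣ A ∣ i (subst T (sym eq) _)))
  ... | false = refl

layer-*ʳ : ∀ {n} i (f : Subset n → ℕ) c → layer i (λ A → f A * c) ≡ layer i f * c
layer-*ʳ i f c = trans (∑-cong λ A → sym (*-assoc (bit (∣ A ∣ ≡ᵇ i)) (f A) c)) (∑-*ʳ (λ A → bit (∣ A ∣ ≡ᵇ i) * f A) c)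

∑-≤-by-layers : ∀ {n} N → n ≤ N → (f g : Subset n → ℕ) →
  (∀ i i′ → i + i′ ≡ N → layer i f + layer i′ f ≤ layer i g + layer i′ g) → ∑ f ≤ ∑ g
∑-≤-by-layers N n≤N f g h = subst₂ _≤_ (sym (∑-layers (s≤s n≤N) f)) (sym (∑-layers (s≤s n≤N) g))
  (sum-≤-by-pairs {suc N} (λ i → layer (toℕ i) f) (λ i → layer (toℕ i) g)
    λ i → h (toℕ i) (toℕ (opposite i)) (complementary i))
  where
  complementary : ∀ (i : Fin (suc N)) → toℕ i + toℕ (opposite i) ≡ N
  complementary i rewrite Fin.opposite-prop i = m+[n∸m]≡n (Fin.toℕ≤pred[n] i)

∣∣<-missing : ∀ {n} (x : Fin n) A → lookup A x ≡ outside → ∣ A ∣ < n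
∣∣<-missing {n} x A x∉A with ∣updateAt∣ x A (const inside)
... | eq rewrite x∉A =
  ≤-trans (≤-reflexive (trans (+-comm 1 ∣ A ∣) (trans (sym eq) (+-identityʳ _)))) (∣p∣≤n (updateAt A x (const inside)))

-- D consists of the sets that belong to the family only together with the head;
-- two of them can conflict only if their sizes add up to N. Of two layers of sizes
-- i ≢ i′ one is kept whole: keeping i pays for dropping i′ if
-- d i′ * w (1 + i′) ≤ d i * w i, and since w is antitone this holds one way or the
-- other. In the layer of size N/2 the sets that avoid a popular element j are kept.
module Choice {ℓ} (K m t : ℕ) (D : Family ℓ) (t<ℓ : t < ℓ)
  (threshold : (K ∸ suc t) * (suc t + 1) ≤ suc ℓ + m) where

  w : ℕ → ℕ
  w = weight K m

  -- The value of `∣ A ∪ B ∣ + ∣ A ∩ B ∣` for a pair that covers all `ℓ` elements and misses the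
  -- required intersection `suc t` by one.
  N : ℕ
  N = ℓ + t

  d : ℕ → ℕ
  d i = layer i (bit ∘ D)

  avoiding : Fin ℓ → ℕ → ℕ
  avoiding j i = layer i (λ A → bit (D A ∧ not (lookup A j)))

  wins : ℕ → Bool
  wins i = d (N ∸ i) * w (suc (N ∸ i)) ≤ᵇ d i * w i

  -- The test is always evaluated at the smaller of i and N - i, so of two different complementary
  -- sizes exactly one is kept, even in a tie.
  kept : ℕ → Bool
  kept i = if i <ᵇ (N ∸ i) then wins i else not (wins (N ∸ i))

  Beats : ℕ → ℕ → Set
  Beats i i′ = kept i ≡ true × kept i′ ≡ false × d i′ * w (suc i′) ≤ d i * w i

  <ᵇ-true : ∀ {i j} → i < j → (i <ᵇ j) ≡ true
  <ᵇ-true {i} {j} i<j with i <ᵇ j | <⇒<ᵇ i<j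
  ... | true | _ = refl

  <ᵇ-false : ∀ {i j} → i < j → (j <ᵇ i) ≡ false
  <ᵇ-false {i} {j} i<j with j <ᵇ i in eq
  ... | false = refl
  ... | true  = contradiction (<ᵇ⇒< j i (subst T (sym eq) _)) (<⇒≯ i<j)

  beats-total : ∀ i i′ → i + i′ ≡ N → i < i′ → Beats i i′ ⊎ Beats i′ i
  beats-total i i′ eq i<i′ = go _ refl
    where
    N∸i : N ∸ i ≡ i′
    N∸i = trans (cong (_∸ i) (sym eq)) (m+n∸m≡n i i′)
    N∸i′ : N ∸ i′ ≡ i
    N∸i′ = trans (cong (_∸ i′) (sym eq)) (m+n∸n≡m i i′)
    kept-i : kept i ≡ (d i′ * w (suc i′) ≤ᵇ d i * w i)
    kept-i rewrite N∸i | <ᵇ-true i<i′ = refl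
    kept-i′ : kept i′ ≡ not (d i′ * w (suc i′) ≤ᵇ d i * w i)
    kept-i′ rewrite N∸i′ | <ᵇ-false i<i′ | N∸i = refl
    go : ∀ b → (d i′ * w (suc i′) ≤ᵇ d i * w i) ≡ b → Beats i i′ ⊎ Beats i′ i
    go true eq  = inj₁ (trans kept-i eq , trans kept-i′ (cong not eq) , ≤ᵇ⇒≤ _ _ (subst T (sym eq) _))
    -- The failed test gives d i * w i < d i′ * w (1 + i′); lowering the left side and raising the
    -- right side by antitonicity gives the mirrored inequality.
    go false eq = inj₂ (trans kept-i′ (cong not eq) , trans kept-i eq , (begin
      d i * w (suc i)   ≤⟨ *-monoʳ-≤ (d i) (weight-antitone K m i) ⟩
      d i * w i         ≤⟨ <⇒≤ (≰⇒> λ le → subst T eq (≤⇒≤ᵇ le)) ⟩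
      d i′ * w (suc i′) ≤⟨ *-monoʳ-≤ (d i′) (weight-antitone K m i′) ⟩
      d i′ * w i′       ∎))
      where open ≤-Reasoning

  -- Double counting of the pairs of a set `A` of size `i` in `D` and an element outside `A`.
  sum-avoiding : ∀ i → sum (λ j → avoiding j i) ≡ d i * (ℓ ∸ i)
  sum-avoiding i = begin
    sum (λ j → avoiding j i)
      ≡⟨ ∑-sum-comm {m = ℓ} (λ A j → bit (∣ A ∣ ≡ᵇ i) * bit (D A ∧ not (lookup A j))) ⟨
    ∑ (λ A → sum (λ j → bit (∣ A ∣ ≡ᵇ i) * bit (D A ∧ not (lookup A j))))
      ≡⟨ ∑-cong (λ A → sym (*-distribˡ-sum {ℓ} (bit (∣ A ∣ ≡ᵇ i)) (λ j → bit (D A ∧ not (lookup A j))))) ⟩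
    layer i (λ A → sum (λ j → bit (D A ∧ not (lookup A j))))
      ≡⟨ layer-cong i count ⟩
    layer i (λ A → bit (D A) * (ℓ ∸ i))
      ≡⟨ layer-*ʳ i (bit ∘ D) (ℓ ∸ i) ⟩
    d i * (ℓ ∸ i) ∎
    where
    open ≡-Reasoning
    count : ∀ A → ∣ A ∣ ≡ i → sum (λ j → bit (D A ∧ not (lookup A j))) ≡ bit (D A) * (ℓ ∸ i)
    count A refl with D A
    ... | true  = trans (sym (m+n∸n≡m _ ∣ A ∣)) (trans (cong (_∸ ∣ A ∣) (sum-missing A)) (sym (*-identityˡ _)))
    ... | false = sum-replicate-zero ℓ

  -- Some `j` is avoided at least as often as the average. Only the size `⌊ N /2⌋` can satisfy i + i
  -- = N, so one `j` suffices.
  popular : ∃[ j ] ∀ i → i + i ≡ N → d i * (ℓ ∸ i) ≤ ℓ * avoiding j i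
  popular with average (λ j → avoiding j ⌊ N /2⌋) t<ℓ
    where
    average : ∀ {ℓ t} (f : Fin ℓ → ℕ) → t < ℓ → ∃[ j ] sum f ≤ ℓ * f j
    average {suc ℓ} f _ = average≤maximum f
  ... | j , avg = j , λ i eq →
    subst (λ i → d i * (ℓ ∸ i) ≤ ℓ * avoiding j i) (trans (cong ⌊_/2⌋ (sym eq)) (sym (n≡⌊n+n/2⌋ i)))
      (subst (_≤ ℓ * avoiding j ⌊ N /2⌋) (sum-avoiding ⌊ N /2⌋) avg)

  j : Fin ℓ
  j = proj₁ popular

  keep : Family ℓ
  keep A = if ∣ A ∣ + ∣ A ∣ ≡ᵇ N then not (lookup A j) else kept ∣ A ∣

  keep-middle : ∀ {A} → ∣ A ∣ + ∣ A ∣ ≡ N → keep A ≡ not (lookup A j)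
  keep-middle {A} eq with ∣ A ∣ + ∣ A ∣ ≡ᵇ N | ≡⇒≡ᵇ (∣ A ∣ + ∣ A ∣) N eq
  ... | true | _ = refl

  keep-other : ∀ {A} → ∣ A ∣ + ∣ A ∣ ≢ N → keep A ≡ kept ∣ A ∣
  keep-other {A} neq with ∣ A ∣ + ∣ A ∣ ≡ᵇ N in eq
  ... | true  = contradiction (≡ᵇ⇒≡ _ _ (subst T (sym eq) _)) neq
  ... | false = refl

  <-off-middle : ∀ {i i′} → i + i′ ≡ N → i < i′ → i + i ≢ N × i′ + i′ ≢ N
  <-off-middle {i} {i′} eq i<i′ =
    (λ eq′ → <⇒≢ (+-monoʳ-< i i<i′) (trans eq′ (sym eq))) ,
    (λ eq′ → <⇒≢ (+-monoˡ-< i′ i<i′) (trans eq (sym eq′)))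

  ordered-incompatible : ∀ A B → ∣ A ∣ < ∣ B ∣ → ∣ A ∣ + ∣ B ∣ ≡ N → keep A ≡ true → keep B ≢ true
  ordered-incompatible A B A<B eq kA kB with <-off-middle eq A<B | beats-total ∣ A ∣ ∣ B ∣ eq A<B
  ... | _ , B-off | inj₁ (_ , ¬kB , _) =
    contradiction (trans (sym kB) (trans (keep-other {B} B-off) ¬kB)) λ ()
  ... | A-off , _ | inj₂ (_ , ¬kA , _) =
    contradiction (trans (sym kA) (trans (keep-other {A} A-off) ¬kA)) λ ()

  -- Of two different complementary sizes only one is kept, and two kept sets of the middle size
  -- both avoid `j`. Hence kept sets never cover everything, as a conflict would require.
  keep-compatible : ∀ A B → keep A ≡ true → keep B ≡ true → ∣ A ∣ + ∣ B ∣ ≡ N → ∣ A ∪ B ∣ < ℓ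
  keep-compatible A B kA kB eq with <-cmp ∣ A ∣ ∣ B ∣
  ... | tri< A<B _ _ = contradiction kB (ordered-incompatible A B A<B eq kA)
  ... | tri> _ _ B<A = contradiction kA (ordered-incompatible B A B<A (trans (+-comm ∣ B ∣ ∣ A ∣) eq) kB)
  ... | tri≈ _ A≡B _ = ∣∣<-missing j (A ∪ B)
    (trans (lookup-zipWith _∨_ j A B) (cong₂ _∨_ (missed A (trans (cong (∣ A ∣ +_) A≡B) eq) kA)
                                                 (missed B (trans (cong (_+ ∣ B ∣) (sym A≡B)) eq) kB)))
    where
    missed : ∀ A → ∣ A ∣ + ∣ A ∣ ≡ N → keep A ≡ true → lookup A j ≡ outside
    missed A eq kA = trans (sym (Bool.not-involutive _)) (cong not (trans (sym (keep-middle {A} eq)) kA))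

  -- `loss` is the weight that a set of `D` carries together with the head. `gain` is the weight of
  -- a kept trace once the head is among the free elements, written out by Pascal's rule.
  loss gain : Subset ℓ → ℕ
  loss A = bit (D A) * w (suc ∣ A ∣)
  gain A = bit (D A ∧ keep A) * (w ∣ A ∣ + w (suc ∣ A ∣))

  layer-loss : ∀ i → layer i loss ≡ d i * w (suc i)
  layer-loss i = trans (layer-cong i λ A A≡i → cong (λ i → bit (D A) * w (suc i)) A≡i)
    (layer-*ʳ i (bit ∘ D) (w (suc i)))

  layer-gain : ∀ i (p : Family ℓ) → (∀ A → ∣ A ∣ ≡ i → keep A ≡ p A) →
    layer i gain ≡ layer i (λ A → bit (D A ∧ p A)) * (w i + w (suc i))
  layer-gain i p keep≡p = trans
    (layer-cong i λ A A≡i → cong₂ (λ b i → bit (D A ∧ b) * (w i + w (suc i))) (keep≡p A A≡i) A≡i)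
    (layer-*ʳ i (λ A → bit (D A ∧ p A)) (w i + w (suc i)))

  beats⇒≤ : ∀ {i i′} → i + i ≢ N → Beats i i′ → layer i loss + layer i′ loss ≤ layer i gain
  beats⇒≤ {i} {i′} off (kept-i , _ , wins) = begin
    layer i loss + layer i′ loss              ≡⟨ cong₂ _+_ (layer-loss i) (layer-loss i′) ⟩
    d i * w (suc i) + d i′ * w (suc i′)       ≤⟨ +-monoʳ-≤ _ wins ⟩
    d i * w (suc i) + d i * w i               ≡⟨ +-comm (d i * w (suc i)) _ ⟩
    d i * w i + d i * w (suc i)               ≡⟨ *-distribˡ-+ (d i) (w i) (w (suc i)) ⟨
    d i * (w i + w (suc i))                   ≡⟨ cong (_* (w i + w (suc i))) drop-true ⟨
    layer i (λ A → bit (D A ∧ true)) * (w i + w (suc i)) ≡⟨ layer-gain i (const true) all-kept ⟨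
    layer i gain                              ∎
    where
    open ≤-Reasoning
    drop-true : layer i (λ A → bit (D A ∧ true)) ≡ d i
    drop-true = layer-cong i λ A _ → cong bit (Bool.∧-identityʳ (D A))
    all-kept : ∀ A → ∣ A ∣ ≡ i → keep A ≡ true
    all-kept A refl = trans (keep-other {A} off) kept-i

  -- From 2 i = ℓ + t and t < ℓ follows t < i; writing i = t + 1 + s gives ℓ - i = s + 1, the form
  -- that `middle-weights` expects.
  middle-shape : ∀ i → i + i ≡ N → i * w (suc i) ≤ (ℓ ∸ i) * w i × i ≤ ℓ
  middle-shape i eq = ineq , i≤ℓ
    where
    t<i : t < i
    t<i = m+m<n+n⇒m<n (subst (t + t <_) (sym eq) (+-monoˡ-< t t<ℓ))
    i≤ℓ : i ≤ ℓ
    i≤ℓ = +-cancelʳ-≤ i i ℓ (≤-trans (≤-reflexive eq) (+-monoʳ-≤ ℓ (<⇒≤ t<i)))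
    s : ℕ
    s = i ∸ suc t
    i≡ : suc (t + s) ≡ i
    i≡ = m+[n∸m]≡n t<i
    ℓ≡ : i + suc s ≡ ℓ
    ℓ≡ = +-cancelʳ-≡ t (i + suc s) ℓ (trans (lemma i s t) (trans (cong (i +_) i≡) eq))
      where
      lemma : ∀ i s t → i + suc s + t ≡ i + suc (t + s)
      lemma = solve-∀
    ℓ∸i : ℓ ∸ i ≡ suc s
    ℓ∸i = trans (cong (_∸ i) (sym ℓ≡)) (m+n∸m≡n i (suc s))
    ineq : i * w (suc i) ≤ (ℓ ∸ i) * w i
    ineq rewrite ℓ∸i = subst (λ i → i * w (suc i) ≤ suc s * w i) i≡
      (middle-weights K t m s (subst (λ ℓ → (K ∸ suc t) * (suc t + 1) ≤ suc ℓ + m)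
        (trans (sym ℓ≡) (cong (_+ suc s) (sym i≡))) threshold))

  -- After multiplication by ℓ = s + i, the weight inequality trades i w (i + 1) for s w i. What
  -- remains is d i * s times the weight of a kept trace, and averaging bounds d i * s by ℓ times
  -- the number of kept sets.
  middle⇒≤ : ∀ i → i + i ≡ N → layer i loss ≤ layer i gain
  middle⇒≤ i eq with middle-shape i eq
  ... | weights , i≤ℓ = scaled ℓ t<ℓ (begin
    ℓ * layer i loss                              ≡⟨ cong₂ _*_ (sym (m∸n+n≡m i≤ℓ)) (layer-loss i) ⟩
    (s + i) * (d i * w (suc i))                   ≡⟨ spread s i (d i) (w (suc i)) ⟩
    d i * (i * w (suc i) + s * w (suc i))         ≤⟨ *-monoʳ-≤ (d i) (+-monoˡ-≤ _ weights) ⟩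
    d i * (s * w i + s * w (suc i))               ≡⟨ gather s (d i) (w i) (w (suc i)) ⟩
    d i * s * (w i + w (suc i))                   ≤⟨ *-monoˡ-≤ (w i + w (suc i)) (proj₂ popular i eq) ⟩
    ℓ * avoiding j i * (w i + w (suc i))          ≡⟨ *-assoc ℓ _ _ ⟩
    ℓ * (avoiding j i * (w i + w (suc i)))        ≡⟨ cong (ℓ *_) (layer-gain i (λ A → not (lookup A j)) middle) ⟨
    ℓ * layer i gain                              ∎)
    where
    open ≤-Reasoning
    s : ℕ
    s = ℓ ∸ i
    middle : ∀ A → ∣ A ∣ ≡ i → keep A ≡ not (lookup A j)
    middle A refl = keep-middle {A} eq
    spread : ∀ s i d w → (s + i) * (d * w) ≡ d * (i * w + s * w)
    spread = solve-∀
    gather : ∀ s d w w′ → d * (s * w + s * w′) ≡ d * s * (w + w′)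
    gather = solve-∀
    scaled : ∀ {t a b} ℓ → t < ℓ → ℓ * a ≤ ℓ * b → a ≤ b
    scaled (suc ℓ) _ = *-cancelˡ-≤ (suc ℓ)

  loss≤gain : ∑ loss ≤ ∑ gain
  loss≤gain = ∑-≤-by-layers N (m≤m+n ℓ t) loss gain pair
    where
    ordered : ∀ i i′ → i + i′ ≡ N → i < i′ → layer i loss + layer i′ loss ≤ layer i gain + layer i′ gain
    ordered i i′ eq i<i′ with <-off-middle eq i<i′ | beats-total i i′ eq i<i′
    ... | off , _  | inj₁ i-wins  = ≤-trans (beats⇒≤ off i-wins) (m≤m+n _ _)
    ... | _ , off′ | inj₂ i′-wins = ≤-trans (≤-reflexive (+-comm (layer i loss) _))
      (≤-trans (beats⇒≤ off′ i′-wins) (m≤n+m _ _))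
    pair : ∀ i i′ → i + i′ ≡ N → layer i loss + layer i′ loss ≤ layer i gain + layer i′ gain
    pair i i′ eq with <-cmp i i′
    ... | tri< i<i′ _ _ = ordered i i′ eq i<i′
    ... | tri≈ _ refl _ = +-mono-≤ (middle⇒≤ i eq) (middle⇒≤ i eq)
    ... | tri> _ _ i′<i = subst₂ _≤_ (+-comm (layer i′ loss) _) (+-comm (layer i′ gain) _)
      (ordered i′ i (trans (+-comm i′ i) eq) i′<i)

-- Removing the head

difference : ∀ {n} → Family (suc n) → Family n
difference g A = g (inside ∷ A) ∧ not (g (outside ∷ A))

project : ∀ {n} → Family (suc n) → Family n → Family n
project g keep A = g (outside ∷ A) ∨ (g (inside ∷ A) ∧ keep A)

module _ {n} (K m : ℕ) (g : Family (suc n)) (keep : Family n) where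

  private
    w : ℕ → ℕ
    w = weight K m

  -- By Pascal's rule a trace present with and without the head keeps its weight exactly, and one
  -- present only without it does not lose. For the traces in `difference g`, `loss` and `gain` are
  -- added crosswise, so that the comparison is pointwise and free of subtraction.
  total-project : ∑ (λ A → bit (difference g A) * w (suc ∣ A ∣)) ≤
                  ∑ (λ A → bit (difference g A ∧ keep A) * (w ∣ A ∣ + w (suc ∣ A ∣))) →
    total (w ∘ ∣_∣) g ≤ total (weight K (suc m) ∘ ∣_∣) (project g keep)
  total-project loss≤gain = +-cancelʳ-≤ (∑ gain) _ _ (begin
    total (w ∘ ∣_∣) g + ∑ gain            ≡⟨ cong (_+ ∑ gain) (∑-+ before₁ before₀) ⟨
    ∑ (λ A → before₁ A + before₀ A) + ∑ gain ≡⟨ ∑-+ (λ A → before₁ A + before₀ A) gain ⟨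
    ∑ (λ A → before₁ A + before₀ A + gain A) ≤⟨ ∑-mono pointwise ⟩
    ∑ (λ A → after A + loss A)            ≡⟨ ∑-+ after loss ⟩
    ∑ after + ∑ loss                      ≤⟨ +-monoʳ-≤ (∑ after) loss≤gain ⟩
    ∑ after + ∑ gain                      ∎)
    where
    open ≤-Reasoning
    before₁ before₀ after loss gain : Subset n → ℕ
    before₁ A = bit (g (inside ∷ A)) * w (suc ∣ A ∣)
    before₀ A = bit (g (outside ∷ A)) * w ∣ A ∣
    after A = bit (project g keep A) * weight K (suc m) ∣ A ∣
    loss A = bit (difference g A) * w (suc ∣ A ∣)
    gain A = bit (difference g A ∧ keep A) * (w ∣ A ∣ + w (suc ∣ A ∣))
    bits : ∀ x y k a b →
      bit x * b + bit y * a + bit ((x ∧ not y) ∧ k) * (a + b) ≤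
      bit (y ∨ (x ∧ k)) * (a + b) + bit (x ∧ not y) * b
    bits true  true  k     a b = ≤-reflexive (lemma a b)
      where
      lemma : ∀ a b → b + 0 + (a + 0) + 0 ≡ a + b + 0 + 0
      lemma = solve-∀
    bits true  false true  a b = ≤-reflexive (lemma a b)
      where
      lemma : ∀ a b → b + 0 + 0 + (a + b + 0) ≡ a + b + 0 + (b + 0)
      lemma = solve-∀
    bits true  false false a b = ≤-reflexive (trans (+-identityʳ _) (+-identityʳ _))
    bits false true  k     a b = ≤-trans (m≤m+n _ b) (≤-reflexive (lemma a b))
      where
      lemma : ∀ a b → a + 0 + 0 + b ≡ a + b + 0 + 0
      lemma = solve-∀
    bits false false k     a b = z≤n
    pointwise : ∀ A → before₁ A + before₀ A + gain A ≤ after A + loss A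
    pointwise A rewrite weight-pascal K m ∣ A ∣ =
      bits (g (inside ∷ A)) (g (outside ∷ A)) (keep A) (w ∣ A ∣) (w (suc ∣ A ∣))

-- If one of two traces comes from a member without the head, the head contributes nothing to the
-- intersection. Only two kept traces with the head need the extra hypothesis.
project-intersecting : ∀ {n} t (g : Family (suc n)) keep → Intersecting t g →
  (∀ A B → g (inside ∷ A) ≡ true → g (inside ∷ B) ≡ true →
     keep A ≡ true → keep B ≡ true → t ≤ ∣ A ∩ B ∣) →
  Intersecting t (project g keep)
project-intersecting t g keep int kept A B A∈ B∈ = pairwise A B (origin A A∈) (origin B B∈)
  where
  origin : ∀ A → project g keep A ≡ true →
    g (outside ∷ A) ≡ true ⊎ (g (inside ∷ A) ≡ true × keep A ≡ true)
  origin A eq with g (outside ∷ A) | g (inside ∷ A) | keep A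
  ... | true  | _    | _    = inj₁ refl
  ... | false | true | true = inj₂ (refl , refl)
  pairwise : ∀ A B →
    g (outside ∷ A) ≡ true ⊎ (g (inside ∷ A) ≡ true × keep A ≡ true) →
    g (outside ∷ B) ≡ true ⊎ (g (inside ∷ B) ≡ true × keep B ≡ true) → t ≤ ∣ A ∩ B ∣
  pairwise A B (inj₁ gA)        (inj₁ gB)        = int _ _ gA gB
  pairwise A B (inj₁ gA)        (inj₂ (gB , _))  = int _ _ gA gB
  pairwise A B (inj₂ (gA , _))  (inj₁ gB)        = int _ _ gA gB
  pairwise A B (inj₂ (gA , kA)) (inj₂ (gB , kB)) = kept A B gA gB kA kB

total-full : ∀ {n} (w : ℕ → ℕ) (g : Family n) → (∀ A → g A ≡ true → ∣ A ∣ ≡ n) →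
  total (w ∘ ∣_∣) g ≤ w n
total-full {zero} w g full with g []
... | true  = ≤-reflexive (+-identityʳ (w 0))
... | false = z≤n
total-full {suc n} w g full = begin
  ∑ (λ A → bit (g (inside ∷ A)) * w (suc ∣ A ∣)) + ∑ (λ A → bit (g (outside ∷ A)) * w ∣ A ∣)
    ≡⟨ cong (total (w ∘ suc ∘ ∣_∣) (g ∘ (inside ∷_)) +_) (trans (∑-cong empty) (∑-0 n)) ⟩
  total (w ∘ suc ∘ ∣_∣) (g ∘ (inside ∷_)) + 0
    ≡⟨ +-identityʳ _ ⟩
  total (w ∘ suc ∘ ∣_∣) (g ∘ (inside ∷_))
    ≤⟨ total-full (w ∘ suc) (g ∘ (inside ∷_)) (λ A gA → suc-injective (full (inside ∷ A) gA)) ⟩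
  w (suc n) ∎
  where
  open ≤-Reasoning
  empty : ∀ A → bit (g (outside ∷ A)) * w ∣ A ∣ ≡ 0
  empty A with g (outside ∷ A) in gA
  ... | true  = contradiction (full (outside ∷ A) gA) (<⇒≢ (s≤s (∣p∣≤n A)))
  ... | false = refl

-- For t = 0 there are no conflicts and every trace is kept. Otherwise a conflict would force
-- complementary sizes and a full union, which `keep` excludes.
descend : ∀ K m t {n} → t ≤ n → (K ∸ t) * (t + 1) ≤ suc n + m →
  (g : Family (suc n)) → (∀ j → Compression.Stable (shift j) g) → Intersecting t g →
  ∃[ h ] Intersecting {n} t h × total (weight K m ∘ ∣_∣) g ≤ total (weight K (suc m) ∘ ∣_∣) h
descend K m zero    {n} _   _         g stable int =
  project g (const true) , (λ _ _ _ _ → z≤n) , total-project K m g (const true) (∑-mono pointwise)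
  where
  pointwise : ∀ A → bit (difference g A) * weight K m (suc ∣ A ∣) ≤
    bit (difference g A ∧ true) * (weight K m ∣ A ∣ + weight K m (suc ∣ A ∣))
  pointwise A rewrite Bool.∧-identityʳ (difference g A) =
    *-monoʳ-≤ (bit (difference g A)) (m≤n+m _ (weight K m ∣ A ∣))
descend K m (suc t) {n} t<n threshold g stable int =
  project g keep ,
  project-intersecting (suc t) g keep int compatible ,
  total-project K m g keep loss≤gain
  where
  open Choice K m t (difference g) t<n threshold
  compatible : ∀ A B → g (inside ∷ A) ≡ true → g (inside ∷ B) ≡ true →
    keep A ≡ true → keep B ≡ true → suc t ≤ ∣ A ∩ B ∣
  compatible A B gA gB kA kB = ≮⇒≥ λ A∩B<t →
    let sizes , cover = shifted-conflict t g stable int A B gA gB A∩B<t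
    in <⇒≢ (keep-compatible A B kA kB sizes) cover

-- Induction on `d`, the number of elements still to be removed; `m` counts those already removed.
-- The sum d + t + m, and with it the threshold, stays fixed.
intersecting-bound : ∀ K t d m → (K ∸ t) * (t + 1) ≤ d + t + m →
  (g : Family (d + t)) → Intersecting t g →
  total (weight K m ∘ ∣_∣) g ≤ weight K (d + m) t
-- On `t` elements, `t ≤ ∣ A ∩ A ∣` forces `A` to be the full set.
intersecting-bound K t zero    m _         g int = total-full (weight K m) g λ A gA →
  ≤-antisym (∣p∣≤n A) (≤-trans (int A A gA gA) (∣p∩q∣≤∣p∣ A A))
intersecting-bound K t (suc d) m threshold g int =
  let g′ , int′ , stable , total≡ = stabilise shift headBit (weight K m ∘ ∣_∣) shift-decreasing
        (λ j A _ → cong (weight K m) (∣swap∣ j A)) (Intersecting t) (shift-intersecting t) g int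
      h , h-int , total≤ = descend K m t {d + t} (m≤n+m t d) threshold g′ stable int′
  in begin
    total (weight K m ∘ ∣_∣) g        ≡⟨ total≡ ⟨
    total (weight K m ∘ ∣_∣) g′       ≤⟨ total≤ ⟩
    total (weight K (suc m) ∘ ∣_∣) h  ≤⟨ intersecting-bound K t d (suc m)
                                          (subst ((K ∸ t) * (t + 1) ≤_) (sym (+-suc (d + t) m)) threshold) h h-int ⟩
    weight K (d + suc m) t            ≡⟨ cong (λ m → weight K m t) (+-suc d m) ⟩
    weight K (suc d + m) t            ∎
  where open ≤-Reasoning

-- Reduction to t-intersecting families

toggleable : ∀ {n} → ℕ → Fin n → Subset n → Bool
toggleable k x A = not (lookup A x) ∧ (∣ A ∣ <ᵇ k)

toggleable⇒ : ∀ {n} k (x : Fin n) A → toggleable k x A ≡ true → lookup A x ≡ outside × ∣ A ∣ < k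
toggleable⇒ k x A sA with lookup A x | ∣ A ∣ <ᵇ k in eq
... | false | true = refl , <ᵇ⇒< _ _ (subst T (sym eq) _)

∣toggle∣-add : ∀ {n} (x : Fin n) A → lookup A x ≡ outside → ∣ toggle x A ∣ ≡ suc ∣ A ∣
∣toggle∣-add x A x∉A with ∣updateAt∣ x A not
... | eq rewrite x∉A = trans (sym (+-identityʳ _)) (trans eq (+-comm ∣ A ∣ 1))

∣toggle∣-remove : ∀ {n} (x : Fin n) A → lookup A x ≡ inside → suc ∣ toggle x A ∣ ≡ ∣ A ∣
∣toggle∣-remove x A x∈A with ∣updateAt∣ x A not
... | eq rewrite x∈A = trans (+-comm 1 _) (trans eq (+-identityʳ _))

∣toggle∩toggle∣ : ∀ {n} (x : Fin n) A B → lookup A x ≡ outside →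
  ∣ toggle x A ∩ toggle x B ∣ ≡ bit (not (lookup B x)) + ∣ A ∩ B ∣
∣toggle∩toggle∣ x A B x∉A with ∣updateAt∩updateAt∣ x A B not not
... | eq rewrite x∉A = trans (sym (+-identityʳ _)) (trans eq (+-comm ∣ A ∩ B ∣ _))

extend : ∀ {n} → ℕ → Fin n → Compression n
extend k x = record
  { move        = toggle x
  ; source      = toggleable k x
  ; involutive  = toggle-involutive x
  ; source-move = λ A sA → cong (λ b → not b ∧ (∣ toggle x A ∣ <ᵇ k))
      (trans (lookup∘updateAt x A) (cong not (proj₁ (toggleable⇒ k x A sA))))
  ; ∑-move      = ∑-toggle x
  }

extend-decreasing : ∀ {n} k (x : Fin n) → Compression.Decreasing (extend k x) (λ A → n ∸ ∣ A ∣)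
extend-decreasing k x A sA rewrite ∣toggle∣-add x A (proj₁ (toggleable⇒ k x A sA)) =
  ∸-monoʳ-< (n<1+n ∣ A ∣) (∣∣<-missing x A (proj₁ (toggleable⇒ k x A sA)))

-- The hypothesis of the theorem for a pair, after 2∣A∩B∣ is added to both sides of
-- ∣A △ B∣ + t ≤ k.
Close : ∀ {n} → ℕ → ℕ → Subset n → Subset n → Set
Close k t A B = ∣ A ∩ B ∣ < t → ∣ A ∣ + ∣ B ∣ + t ≤ k + 2 * ∣ A ∩ B ∣

Close-sym : ∀ {n} k t (A B : Subset n) → Close k t A B → Close k t B A
Close-sym k t A B close rewrite ∩-comm B A | +-comm ∣ B ∣ ∣ A ∣ = close

-- If c < t, then a + b + t ≤ k + 2 c ≤ a + b + c, a contradiction. So a set with at least `k`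
-- elements already meets every set close to it in `t` elements.
Close-full : ∀ {k t a b c} → (c < t → a + b + t ≤ k + 2 * c) → c ≤ a → k ≤ b → t ≤ c
Close-full {k} {t} {a} {b} {c} close c≤a k≤b = ≮⇒≥ λ c<t → <⇒≱ c<t (+-cancelˡ-≤ (a + b) t c (begin
  a + b + t     ≤⟨ close c<t ⟩
  k + 2 * c     ≤⟨ +-mono-≤ k≤b (+-monoˡ-≤ (c + 0) c≤a) ⟩
  b + (a + (c + 0)) ≡⟨ lemma a b c ⟩
  a + b + c     ∎))
  where
  open ≤-Reasoning
  lemma : ∀ a b c → b + (a + (c + 0)) ≡ a + b + c
  lemma = solve-∀

Admissible : ∀ {n} → ℕ → ℕ → Family n → Set
Admissible k t g = (∀ A → g A ≡ true → ∣ A ∣ ≤ k) × Pairwise (Close k t) g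

-- If `x` lies in `B`, it passes from `B` to `A`, and neither the sum of the sizes nor the
-- intersection changes. Otherwise both sets gain `x`, which adds 2 to each side.
Close-toggle-both : ∀ {n} k t (x : Fin n) A B → lookup A x ≡ outside →
  Close k t A B → Close k t (toggle x A) (toggle x B)
Close-toggle-both k t x A B x∉A close
  rewrite ∣toggle∩toggle∣ x A B x∉A | ∣toggle∣-add x A x∉A with lookup B x in x∈B
... | false rewrite ∣toggle∣-add x B x∈B = λ c<t → subst₂ _≤_ (lhs ∣ A ∣ ∣ B ∣ t) (rhs k ∣ A ∩ B ∣)
                      (+-monoʳ-≤ 2 (close (<⇒≤ c<t)))
  where
  lhs : ∀ a b t → 2 + (a + b + t) ≡ suc a + suc b + t
  lhs = solve-∀
  rhs : ∀ k c → 2 + (k + 2 * c) ≡ k + 2 * suc c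
  rhs = solve-∀
... | true  = λ c<t → subst (λ s → s + t ≤ k + 2 * ∣ A ∩ B ∣)
  (trans (cong (∣ A ∣ +_) (sym (∣toggle∣-remove x B x∈B))) (+-suc _ _)) (close c<t)

-- A set `B` that cannot be extended by `x` either contains it, and then the right side grows by 2
-- and the left by 1, or has at least `k` elements, and then the intersection was never below `t`.
Close-toggle : ∀ {n} k t (x : Fin n) A B → toggleable k x A ≡ true → toggleable k x B ≡ false →
  Close k t A B → Close k t (toggle x A) B
Close-toggle k t x A B sA sB close with toggleable⇒ k x A sA
... | x∉A , _ rewrite ∣updateAt∩∣-outside x A B not x∉A | ∣toggle∣-add x A x∉A with lookup B x
... | true  = λ c<t → ≤-trans (s≤s (≤-trans (close (<⇒≤ c<t)) (n≤1+n _))) (≤-reflexive (rhs k ∣ A ∩ B ∣))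
  where
  rhs : ∀ k c → 2 + (k + 2 * c) ≡ k + 2 * suc c
  rhs = solve-∀
... | false = λ c<t → contradiction
  (Close-full {k = k} close (∣p∩q∣≤∣p∣ A B) (≮⇒≥ λ B<k → subst T sB (<⇒<ᵇ B<k))) (<⇒≱ c<t)

extend-admissible : ∀ {n} k t (x : Fin n) g → Admissible k t g →
  Admissible k t (Compression.compress (extend k x) g)
extend-admissible k t x g (small , close) = small′ ,
  Compression.compress-pairwise (extend k x) (Close-sym k t)
    (λ A B sA _ → Close-toggle-both k t x A B (proj₁ (toggleable⇒ k x A sA)))
    (Close-toggle k t x) close
  where
  small′ : ∀ A → Compression.compress (extend k x) g A ≡ true → ∣ A ∣ ≤ k
  small′ A A∈ with Compression.compress-origin (extend k x) g A A∈
  ... | inj₁ (gA , _) = small A gA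
  ... | inj₂ (sA , _) with toggleable⇒ k x (toggle x A) sA
  ... | x∉ , <k = subst (_≤ k) (trans (sym (∣toggle∣-add x (toggle x A) x∉)) (cong ∣_∣ (toggle-involutive x A))) <k

-- While the intersection is below `t`, stability lets `A` grow by an element outside `A ∪ B`
-- without changing `A ∩ B`. At size `k`, `Close-full` applies.
extended⇒intersecting : ∀ {n} k t → k ≤ n → (g : Family n) → Admissible k t g →
  (∀ x → Compression.Stable (extend k x) g) → Intersecting t g
extended⇒intersecting {n} k t k≤n g (small , close) stable A B gA gB =
  go (k ∸ ∣ A ∣) A (m∸n+n≡m (small A gA)) gA
  where
  go : ∀ r A → r + ∣ A ∣ ≡ k → g A ≡ true → t ≤ ∣ A ∩ B ∣
  go zero    A A≡k gA =
    Close-full {k = k} (subst (λ s → ∣ A ∩ B ∣ < t → s + t ≤ k + 2 * ∣ A ∩ B ∣) (+-comm ∣ A ∣ ∣ B ∣) (close A B gA gB))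
      (∣p∩q∣≤∣q∣ A B) (≤-reflexive (sym A≡k))
  go (suc r) A A≡k gA = ≮⇒≥ λ c<t →
    let x , x∉A∪B = missing-element (A ∪ B) (<-≤-trans (union<k c<t) k≤n)
        x∉A , x∉B = lookup-∪-outside A B x x∉A∪B
        sA        = cong₂ (λ a b → not a ∧ b) x∉A A<k
        size      = trans (cong (r +_) (∣toggle∣-add x A x∉A)) (trans (+-suc r _) A≡k)
        same      = trans (∣updateAt∩∣-outside x A B not x∉A) (cong (λ b → bit b + ∣ A ∩ B ∣) x∉B)
    in <⇒≱ c<t (subst (t ≤_) same (go r (toggle x A) size (stable x A sA gA)))
    where
    open ≤-Reasoning
    A<k : (∣ A ∣ <ᵇ k) ≡ true
    A<k with ∣ A ∣ <ᵇ k | <⇒<ᵇ (subst (∣ A ∣ <_) A≡k (s≤s (m≤n+m ∣ A ∣ r)))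
    ... | true | _ = refl
    -- With c = `∣ A ∩ B ∣`: the union plus 2 c equals `∣ A ∣ + ∣ B ∣` + c, which is below
    -- `∣ A ∣ + ∣ B ∣ + t` ≤ k + 2 c.
    union<k : ∣ A ∩ B ∣ < t → ∣ A ∪ B ∣ < k
    union<k c<t = +-cancelʳ-< (∣ A ∩ B ∣ + ∣ A ∩ B ∣) _ _ (begin-strict
      ∣ A ∪ B ∣ + (∣ A ∩ B ∣ + ∣ A ∩ B ∣) ≡⟨ +-assoc ∣ A ∪ B ∣ _ _ ⟨
      ∣ A ∪ B ∣ + ∣ A ∩ B ∣ + ∣ A ∩ B ∣   ≡⟨ cong (_+ ∣ A ∩ B ∣) (∣∪∣+∣∩∣ A B) ⟩
      ∣ A ∣ + ∣ B ∣ + ∣ A ∩ B ∣           <⟨ +-monoʳ-< (∣ A ∣ + ∣ B ∣) c<t ⟩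
      ∣ A ∣ + ∣ B ∣ + t                   ≤⟨ close A B gA gB c<t ⟩
      k + 2 * ∣ A ∩ B ∣                   ≡⟨ cong (λ c → k + (∣ A ∩ B ∣ + c)) (+-identityʳ _) ⟩
      k + (∣ A ∩ B ∣ + ∣ A ∩ B ∣)         ∎)

-- From lists to families, and the final bound

weight-0 : ∀ k i → i ≤ k → weight (suc k) 0 i ≡ 1
weight-0 k i i≤k rewrite +-∸-assoc 1 i≤k = binomSum-0 (k ∸ i)
  where
  binomSum-0 : ∀ q → binomSum 0 (suc q) ≡ 1
  binomSum-0 zero    = refl
  binomSum-0 (suc q) = trans (+-identityʳ _) (binomSum-0 q)

module _ {n : ℕ} where
  open DecMembership (≡-dec {n = n} Bool._≟_) using (_∈?_)

  family : List (Subset n) → Family n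
  family F A = does (A ∈? F)

  family-sound : ∀ F A → family F A ≡ true → A ∈ F
  family-sound F A eq with A ∈? F
  ... | yes A∈F = A∈F

  -- By uniqueness the first entry is new, so it strictly increases the total.
  length≤total : ∀ F → Unique F → length F ≤ total (const 1) (family F)
  length≤total []      _              = z≤n
  length≤total (A ∷ F) (A≢F ∷ unique) =
    ≤-<-trans (length≤total F unique) (∑-mono-< grows A strict)
    where
    grows : ∀ B → bit (family F B) * 1 ≤ bit (family (A ∷ F) B) * 1
    grows B with B ∈? F
    ... | no  _   = z≤n
    ... | yes B∈F rewrite Bool.∨-zeroʳ (does (≡-dec Bool._≟_ B A)) = ≤-refl
    strict : bit (family F A) * 1 < bit (family (A ∷ F) A) * 1
    strict rewrite dec-false (A ∈? F) (All¬⇒¬Any A≢F) | dec-true (≡-dec Bool._≟_ A A) refl = s≤s z≤n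

family-admissible : ∀ {n} k t (F : List (Subset n)) →
  (∀ A → A ∈ F → ∣ A ∣ ≤ k) →
  (∀ A B → A ∈ F → B ∈ F → ∣ A ∩ B ∣ < t → ∣ A △ B ∣ + t ≤ k) →
  Admissible k t (family F)
family-admissible k t F small far = (λ A A∈ → small A (family-sound F A A∈)) , λ A B A∈ B∈ c<t →
  subst (_≤ k + 2 * ∣ A ∩ B ∣) (rearrange A B)
    (+-monoˡ-≤ (2 * ∣ A ∩ B ∣) (far A B (family-sound F A A∈) (family-sound F B B∈) c<t))
  where
  rearrange : ∀ A B → ∣ A △ B ∣ + t + 2 * ∣ A ∩ B ∣ ≡ ∣ A ∣ + ∣ B ∣ + t
  rearrange A B = trans (lemma ∣ A △ B ∣ t (2 * ∣ A ∩ B ∣)) (cong (_+ t) (∣△∣+2∣∩∣ A B))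
    where
    lemma : ∀ p t c → p + t + c ≡ p + c + t
    lemma = solve-∀

admissible-bound : ∀ k t d → t ≤ k → (suc k ∸ t) * (t + 1) ≤ d + t →
  (g : Family (d + t)) → Admissible k t g → total (const 1) g ≤ binomSum d (suc k ∸ t)
admissible-bound k t d t≤k threshold g adm =
  let g′ , adm′ , stable , total≡ = stabilise (extend k) (λ A → d + t ∸ ∣ A ∣) (const 1) (extend-decreasing k)
        (λ _ _ _ → refl) (Admissible k t) (extend-admissible k t) g adm
  in begin
    total (const 1) g                   ≡⟨ total≡ ⟨
    -- With no free elements, a set of size at most `k` has exactly one extension, itself, so
    -- counting is the weight at m = 0.
    total (const 1) g′                  ≡⟨ ∑-cong (unit-weight g′ (proj₁ adm′)) ⟩
    total (weight (suc k) 0 ∘ ∣_∣) g′   ≤⟨ intersecting-bound (suc k) t d 0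
                                             (≤-trans threshold (≤-reflexive (sym (+-identityʳ _)))) g′
                                             (extended⇒intersecting k t k≤n g′ adm′ stable) ⟩
    binomSum (d + 0) (suc k ∸ t)        ≡⟨ cong (λ m → binomSum m (suc k ∸ t)) (+-identityʳ d) ⟩
    binomSum d (suc k ∸ t)              ∎
  where
  open ≤-Reasoning
  unit-weight : ∀ (g : Family (d + t)) → (∀ A → g A ≡ true → ∣ A ∣ ≤ k) →
    ∀ A → bit (g A) * 1 ≡ bit (g A) * weight (suc k) 0 ∣ A ∣
  unit-weight g small A with g A in gA
  ... | true  = cong (_+ 0) (sym (weight-0 k ∣ A ∣ (small A gA)))
  ... | false = refl
  -- With r = k - t, the threshold (r + 1)(t + 1) exceeds r + t = k by r t + 1.
  k≤n : k ≤ d + t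
  k≤n = begin
    k                      ≡⟨ m∸n+n≡m t≤k ⟨
    (k ∸ t) + t            ≤⟨ m≤m+n _ ((k ∸ t) * t + 1) ⟩
    (k ∸ t) + t + ((k ∸ t) * t + 1) ≡⟨ lemma (k ∸ t) t ⟩
    suc (k ∸ t) * (t + 1)  ≡⟨ cong (_* (t + 1)) (+-∸-assoc 1 t≤k) ⟨
    (suc k ∸ t) * (t + 1)  ≤⟨ threshold ⟩
    d + t                  ∎
    where
    lemma : ∀ r t → r + t + (r * t + 1) ≡ suc r * (t + 1)
    lemma = solve-∀

theorem1p2 : (n k t : ℕ) → (k + 1 ∸ t) * (t + 1) ≤ n →
    (F : List (Subset n)) → Unique F →
    (∀ A → A ∈ F → ∣ A ∣ ≤ k) →
    (∀ A B → A ∈ F → B ∈ F → ∣ A ∩ B ∣ < t → ∣ A △ B ∣ + t ≤ k) →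
    length F ≤ binomSum (n ∸ t) (k + 1 ∸ t)
theorem1p2 n k t threshold F unique small far rewrite +-comm k 1 with t ≤? k
theorem1p2 n k t threshold []      unique small far | no  t≰k = z≤n
-- For t > k a member is compared with itself: it meets itself in fewer than `t` elements, and the
-- hypothesis then yields t ≤ k.
theorem1p2 n k t threshold (A ∷ F) unique small far | no  t≰k =
  contradiction (≤-trans (m≤n+m t ∣ A △ A ∣) (far A A (here refl) (here refl) meet)) t≰k
  where
  meet : ∣ A ∩ A ∣ < t
  meet = ≤-<-trans (∣p∩q∣≤∣p∣ A A) (≤-<-trans (small A (here refl)) (≰⇒> t≰k))
theorem1p2 n k t threshold F       unique small far | yes t≤k = ≤-trans (length≤total F unique)
  (bound n (m∸n+n≡m t≤n) threshold (family F) (family-admissible k t F small far))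
  where
  t≤n : t ≤ n
  t≤n = ≤-trans (≤-trans (m≤m+n t 1) (≤-trans (m≤m+n (t + 1) ((k ∸ t) * (t + 1)))
    (≤-reflexive (cong (_* (t + 1)) (sym (+-∸-assoc 1 t≤k)))))) threshold
  -- Generalising over `n` allows the equation to be matched by `refl`, so that the ground set has
  -- the form `d + t`.
  bound : ∀ n → n ∸ t + t ≡ n → (suc k ∸ t) * (t + 1) ≤ n → (g : Family n) → Admissible k t g →
    total (const 1) g ≤ binomSum (n ∸ t) (suc k ∸ t)
  bound n eq with n ∸ t
  bound n refl | d = admissible-bound k t d t≤k
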